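{- Let $n\ge 1$, $t\ge 1$ and let $\mathbf a\in SST_{2n}(\varpi_t)$ be a column of length $t$. Then $\mathbf a\in SpT_{2n}(\varpi_t)$ (i.e. $\mathbf a$ is symplectic) if and only if, for some $k\ge 0$, $\mathbf a$ can be written as a concatenation $$\mathbf a=X^{(0)}\mathbf A_1X^{(1)}\mathbf A_2\cdots \mathbf A_{k-1}X^{(k-1)}\mathbf A_kX^{(k)},$$ where (1) for $i=0,1,\dots,k$, $X^{(i)}$ is a column word of length $p_i\ge 0$, and $\mathbf s(X^{(0)}X^{(1)}\cdots X^{(k)})\cap \mathbf a=\emptyset$; (2) for $i=1,\dots,k$, $\mathbf A_i=(a_i,a_i+1,\dots,a_i+t_i-1)$ with $a_i$ odd and $t_i\ge 2$ even is a maximal nonempty interval contained in $\mathbf a$ such that $\mathbf s(\mathbf A_i)=\mathbf A_i$; moreover $t=\sum_{i=1}^k t_i+\sum_{i=0}^k p_i\in\{1,\dots,n\}$, and for $i=1,\dots,k$ $$a_i\ge 2t^{(i-1)}+t_i+1,\qquad\text{where } t^{(i-1)}:=\sum_{j=1}^{i-1}t_j+\sum_{j=0}^{i-1}p_j\quad(\text{so } t^{(0)}=p_0).$$ Moreover, this decomposition is unique in the sense that the maximal nonempty intervals $\mathbf A_i$ fixed by $\mathbf s$ are uniquely determined by $\mathbf a$: their union is the part of $\mathbf a$ fixed by $\mathbf s$, i.e. $\{x\in\mathbf a:\mathbf s(x)\in\mathbf a\}$, and what remains is the subword $\mathbf a\setminus\bigsqcup_{i=1}^k\mathbf A_i$,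 which satisfies $\mathbf s(\mathbf a\setminus\bigsqcup_{i=1}^k\mathbf A_i)\cap\mathbf a=\emptyset$.
   Context: $SST_{2n}(\varpi_t)$ is the set of columns of length $t$ on the alphabet $\{1,\dots,2n\}$, i.e. strictly increasing sequences $\mathbf a=(b_1<b_2<\dots<b_t)$ with entries in $\{1,\dots,2n\}$; a column is often identified with the set of its entries, or with the word $b_1b_2\cdots b_t$. A column word is a strictly increasing word (possibly empty). $SpT_{2n}(\varpi_t)$ is the subset of symplectic columns, those with $b_k\ge 2k-1$ for all $k=1,\dots,t$. The parity involution $\mathbf s:\mathbb Z\to\mathbb Z$ is $\mathbf s(x)=x+1$ if $x$ is odd and $\mathbf s(x)=x-1$ if $x$ is even; for a set or word $X$, $\mathbf s(X)=\{\mathbf s(x):x\in X\}$. An interval is a set of consecutive integers. "Maximal nonempty interval fixed by $\mathbf s$" means maximal for inclusion among the nonempty intervals $I\subseteq\mathbf a$ with $\mathbf s(I)=I$. -}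

module Defs where

open import Data.Fin.Base using (Fin; suc; toℕ; inject)
open import Data.Integer.Base as ℤ using (ℤ; ∣_∣)
open import Data.List.Base
  using (List; []; _++_; map; concat; filter; length; lookup; applyUpTo; tabulate)
open import Data.List.Relation.Binary.BagAndSetEquality using (_∼[_]_; set)
open import Data.List.Relation.Binary.Disjoint.Propositional using (Disjoint)
open import Data.List.Relation.Binary.Subset.Propositional using (_⊆_)
open import Data.List.Relation.Unary.All using (All)
open import Data.List.Relation.Unary.Linked using (Linked)
open import Data.Nat.Base
open import Data.Nat.Properties using (_≟_; +-0-commutativeMonoid)
open import Data.List.Membership.DecPropositional _≟_ using (_∉?_)
open import Data.Parity.Base using (0ℙ; 1ℙ)
open import Data.Product.Base using (_×_; ∃₂)
open import Data.Vec.Functional using (Vector; head; tail)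
open import Relation.Binary.PropositionalEquality.Core using (_≡_; _≢_)

open import Algebra.Properties.CommutativeMonoid.Sum +-0-commutativeMonoid
  using (sum-syntax; sum⁺-syntax)

-- Words are also used to represent the finite sets of their letters.

Word : Set
Word = List ℕ

IsColumnWord : Word → Set
IsColumnWord = Linked _<_

_∖_ : Word → Word → Word
X ∖ Y = filter (_∉? Y) X

s : ℤ → ℤ
s x with parity ∣ x ∣
... | 0ℙ = ℤ.pred x
... | 1ℙ = ℤ.suc x

-- Letters are naturals, but s acts on ℤ, so that statements about s-images are
-- made in ℤ.

⟦_⟧ : Word → List ℤ
⟦ X ⟧ = map ℤ.+_ X

s⟦_⟧ : Word → List ℤ
s⟦ X ⟧ = map s ⟦ X ⟧

record Column (n t : ℕ) : Set where
  field
    word       : Word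
    length≡t   : length word ≡ t
    increasing : IsColumnWord word
    alphabet   : All (λ b → 1 ≤ b × b ≤ 2 * n) word

-- The k-th entry (k ≥ 1) is at least 2k − 1; list positions start at 0.

IsSymplectic : ∀ {n t} → Column n t → Set
IsSymplectic 𝐚 = ∀ (j : Fin (length word)) → 2 * suc (toℕ j) ∸ 1 ≤ lookup word j
  where open Column 𝐚

interval : ℕ → ℕ → Word
interval c ℓ = applyUpTo (c +_) ℓ

IsInterval : Word → Set
IsInterval I = ∃₂ λ c ℓ → I ≡ interval c ℓ

record FixedInterval (a I : Word) : Set where
  field
    isInterval : IsInterval I
    nonempty   : I ≢ []
    contained  : I ⊆ a
    fixed      : s⟦ I ⟧ ∼[ set ] ⟦ I ⟧

record MaximalFixedInterval (a I : Word) : Set where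
  field
    fixedInterval : FixedInterval a I
    maximal       : ∀ J → FixedInterval a J → I ⊆ J → J ⊆ I

interleave : ∀ {k} → Vector Word (suc k) → Vector Word k → Word
interleave {zero}  X A = head X
interleave {suc k} X A = head X ++ head A ++ interleave (tail X) (tail A)

-- A i is the block Aᵢ₊₁ (i < k), while X i is X⁽ⁱ⁾ (i ≤ k); so A i follows X i, and
-- before i below is t⁽ⁱ⁾, the number of letters preceding A i.

record Decomposition {n t : ℕ} (𝐚 : Column n t) : Set where
  open Column 𝐚 using (word)
  field
    k     : ℕ
    X     : Vector Word (suc k)
    start : Vector ℕ k
    len   : Vector ℕ k

  A : Vector Word k
  A i = interval (start i) (len i)

  p : Vector ℕ (suc k)
  p i = length (X i)

  before : Fin k → ℕ
  before i = ∑[ j < toℕ i ] len (inject {i = i} j)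
           + ∑[ j ≤ toℕ i ] p (inject {i = suc i} j)

  blocks : List Word
  blocks = tabulate A

  remainder : Word
  remainder = concat (tabulate X)

  field
    decomposes : word ≡ interleave X A
    X-column   : ∀ i → IsColumnWord (X i)
    X-disjoint : Disjoint s⟦ remainder ⟧ ⟦ word ⟧
    start-odd  : ∀ i → parity (start i) ≡ 1ℙ
    len-even   : ∀ i → parity (len i) ≡ 0ℙ
    len≥2      : ∀ i → len i ≥ 2
    A-maximal  : ∀ i → MaximalFixedInterval word (A i)
    t≡∑        : t ≡ ∑[ i < k ] len i + ∑[ i ≤ k ] p i
    1≤t        : 1 ≤ t
    t≤n        : t ≤ n
    start≥     : ∀ i → start i ≥ 2 * before i + len i + 1

{-# OPTIONS --safe #-}
module Submission where

-- Group the letters into pairs {2j − 1, 2j}. The maximal s-fixed intervals are the maximal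
-- runs of complete consecutive pairs in a; reading a from left to right, each letter either
-- completes a pair, which starts or prolongs a run, or is unpaired and goes to a gap.
-- Symplecticity on a run says exactly aᵢ ≥ 2t⁽ⁱ⁻¹⁾ + tᵢ, sharpened by 1 because aᵢ is odd
-- and the right-hand side even; on the gaps it is automatic, because there consecutive
-- letters lie in different pairs while a run ends at an even letter that is already
-- at least twice its position.

open import Defs
open import Data.Fin.Base using (Fin; zero; suc; toℕ; inject)
open import Data.Integer.Base using (+_)
import Data.Integer.Properties as ℤ
open import Data.List.Base
  using (List; []; _∷_; _++_; applyUpTo; concat; filter; length; lookup; tabulate)
open import Data.List.Membership.Propositional using (_∈_; _∉_)
open import Data.List.Membership.Propositional.Properties
open import Data.List.Properties
  using (∷-injective; ++-assoc; ++-identityʳ; ++-cancelˡ; length-++; length-applyUpTo;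
         filter-++; filter-all; filter-none)
open import Data.List.Relation.Binary.BagAndSetEquality using (_∼[_]_; set)
open import Data.List.Relation.Binary.Disjoint.Propositional using (Disjoint)
open import Data.List.Relation.Binary.Subset.Propositional using (_⊆_)
open import Data.List.Relation.Binary.Subset.Propositional.Properties using (⊆-reflexive)
open import Data.List.Relation.Unary.All as All using (All; []; _∷_)
import Data.List.Relation.Unary.All.Properties as All
open import Data.List.Relation.Unary.AllPairs using (AllPairs; []; _∷_)
open import Data.List.Relation.Unary.Any using (here; there)
open import Data.List.Relation.Unary.Linked.Properties
  using (Linked⇒AllPairs; AllPairs⇒Linked)
open import Data.Nat.Base
open import Data.Nat.Properties
open import Data.Nat.Tactic.RingSolver using (solve-∀)
open import Data.List.Membership.DecPropositional _≟_ using (_∉?_)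
open import Data.Parity.Base as ℙ using (0ℙ; 1ℙ)
import Data.Parity.Properties as ℙ
open import Data.Product.Base using (∃; _×_; _,_; proj₁; proj₂)
open import Data.Sum.Base using (_⊎_; inj₁; inj₂; [_,_]′)
open import Data.Vec.Functional as Vector using (Vector; head; tail)
open import Function.Base using (_∘_; case_of_)
open import Function.Bundles using (_⇔_; mk⇔; Equivalence)
open import Relation.Binary.PropositionalEquality
open import Relation.Nullary using (Dec; ¬_; yes; no; contradiction)
open import Relation.Nullary.Decidable using (_×-dec_)

open import Algebra.Properties.CommutativeMonoid.Sum +-0-commutativeMonoid
  using (sum-syntax; sum⁺-syntax)

private
  variable
    c ℓ x y : ℕ
    a w : Word

-- Parity of letters and the involution as a relation.

Odd Even : ℕ → Set
Odd  x = parity x ≡ 1ℙ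
Even x = parity x ≡ 0ℙ

odd-suc : ∀ x → Odd x → Even (suc x)
odd-suc (suc zero)    _ = refl
odd-suc (suc (suc x)) o = odd-suc x o

even-suc : ∀ x → Even x → Odd (suc x)
even-suc zero          _ = refl
even-suc (suc (suc x)) e = even-suc x e

odd⇒¬even : ∀ x → Odd x → ¬ Even x
odd⇒¬even _ o e with () ← trans (sym o) e

odd⇒≥1 : Odd x → 1 ≤ x
odd⇒≥1 {suc x} _ = z<s

odd+even : ∀ c ℓ → Odd c → Even ℓ → Odd (c + ℓ)
odd+even c ℓ o e =
  trans (ℙ.+-homo-+ c ℓ) (cong₂ ℙ._+_ o e)

even-double : ∀ m → Even (2 * m)
even-double m = ℙ.*-homo-* 2 m

-- The letter after `x` is even, so it cannot be `y`. Thus a strict inequality between two odd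
-- interval ends leaves room for a complete pair `x`, `suc x`.
odd-gap : Odd x → Odd y → x < y → suc x < y
odd-gap {x} ox oy x<y = ≤∧≢⇒< x<y λ { refl → odd⇒¬even (suc x) oy (odd-suc x ox) }

infix 4 _⋈_

-- The graph of s on the positive letters.
data _⋈_ : ℕ → ℕ → Set where
  up   : Odd x → x ⋈ suc x
  down : Odd x → suc x ⋈ x

⋈-sym : x ⋈ y → y ⋈ x
⋈-sym (up o)   = down o
⋈-sym (down o) = up o

s-⋈ : x ⋈ y → s (+ x) ≡ + y
s-⋈ (up o)         rewrite o = refl
s-⋈ (down {x} o)   rewrite odd-suc x o = refl

-- Positivity excludes 0, whose image under `s` is the integer -1 and so not a letter.
partner : 1 ≤ x → ∃ λ y → x ⋈ y
partner {suc x} _ with parity x in eq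
... | 1ℙ = x , down eq
... | 0ℙ = suc (suc x) , up (even-suc x eq)

∈-⟦⟧⁻ : + x ∈ ⟦ a ⟧ → x ∈ a
∈-⟦⟧⁻ x∈ with _ , y∈a , eq ← ∈-map⁻ +_ x∈ = subst (_∈ _) (sym (ℤ.+-injective eq)) y∈a

s∈⟦⟧⁻ : 1 ≤ x → s (+ x) ∈ ⟦ a ⟧ → ∃ λ y → y ∈ a × x ⋈ y
s∈⟦⟧⁻ 1≤x sx∈ with y , x⋈y ← partner 1≤x =
  y , ∈-⟦⟧⁻ (subst (_∈ _) (s-⋈ x⋈y) sx∈) , x⋈y

s∈⟦⟧⁺ : x ⋈ y → y ∈ a → s (+ x) ∈ ⟦ a ⟧
s∈⟦⟧⁺ x⋈y y∈a = subst (_∈ _) (sym (s-⋈ x⋈y)) (∈-map⁺ +_ y∈a)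

-- Intervals fixed by the involution.

Closed : Word → Set
Closed I = ∀ {x y} → x ∈ I → x ⋈ y → y ∈ I

-- As `s` is an involution, the reverse inclusion follows from the forward one: a letter is the
-- image of its own partner.
closed⇒fixed : ∀ {I} → All (1 ≤_) I → Closed I → s⟦ I ⟧ ∼[ set ] ⟦ I ⟧
closed⇒fixed {I} pos closed = mk⇔ to from
  where
  to : ∀ {z} → z ∈ s⟦ I ⟧ → z ∈ ⟦ I ⟧
  to z∈ with _ , +x∈ , refl ← ∈-map⁻ s z∈ with _ , x∈I , refl ← ∈-map⁻ +_ +x∈
    = s∈⟦⟧⁺ x⋈y (closed x∈I x⋈y)
    where x⋈y = proj₂ (partner (All.lookup pos x∈I))
  from : ∀ {z} → z ∈ ⟦ I ⟧ → z ∈ s⟦ I ⟧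
  from z∈ with _ , x∈I , refl ← ∈-map⁻ +_ z∈
    with y , x⋈y ← partner (All.lookup pos x∈I)
    = subst (_∈ _) (s-⋈ (⋈-sym x⋈y)) (∈-map⁺ s (∈-map⁺ +_ (closed x∈I x⋈y)))

fixed⇒closed : ∀ {I} → s⟦ I ⟧ ∼[ set ] ⟦ I ⟧ → Closed I
fixed⇒closed fixed x∈I x⋈y = ∈-⟦⟧⁻
  (subst (_∈ _) (s-⋈ x⋈y) (Equivalence.to fixed (∈-map⁺ s (∈-map⁺ +_ x∈I))))

∈-interval⁺ : c ≤ x → x < c + ℓ → x ∈ interval c ℓ
∈-interval⁺ {c} {x} {ℓ} c≤x x<c+ℓ = subst (_∈ interval c ℓ) (m+[n∸m]≡n c≤x)
  (∈-applyUpTo⁺ (λ i → c + i)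
    (+-cancelˡ-< c _ _ (subst (_< c + ℓ) (sym (m+[n∸m]≡n c≤x)) x<c+ℓ)))

∈-interval⁻ : x ∈ interval c ℓ → c ≤ x × x < c + ℓ
∈-interval⁻ {c = c} x∈ with i , i<ℓ , refl ← ∈-applyUpTo⁻ (λ i → c + i) x∈ =
  m≤m+n c i , +-monoʳ-< c i<ℓ

start∈ : 1 ≤ ℓ → c ∈ interval c ℓ
start∈ {ℓ} {c} 1≤ℓ = ∈-interval⁺ ≤-refl (m<m+n c 1≤ℓ)

applyUpTo-cong : ∀ {f g : ℕ → ℕ} → (∀ i → f i ≡ g i) → ∀ n →
                 applyUpTo f n ≡ applyUpTo g n
applyUpTo-cong f≗g zero    = refl
applyUpTo-cong f≗g (suc n) = cong₂ _∷_ (f≗g 0) (applyUpTo-cong (f≗g ∘ suc) n)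

interval-∷ : ∀ c ℓ → interval c (suc ℓ) ≡ c ∷ interval (suc c) ℓ
interval-∷ c ℓ = cong₂ _∷_ (+-identityʳ c) (applyUpTo-cong (+-suc c) ℓ)

interval-++ : ∀ c m ℓ → interval c (m + ℓ) ≡ interval c m ++ interval (c + m) ℓ
interval-++ c zero    ℓ = cong (λ e → interval e ℓ) (sym (+-identityʳ c))
interval-++ c (suc m) ℓ = begin
  interval c (suc (m + ℓ))                          ≡⟨ interval-∷ c (m + ℓ) ⟩
  c ∷ interval (suc c) (m + ℓ)                      ≡⟨ cong (c ∷_) (interval-++ (suc c) m ℓ) ⟩
  c ∷ interval (suc c) m ++ interval (suc c + m) ℓ  ≡⟨ cong₂ _++_ (sym (interval-∷ c m))
                                                         (cong (λ e → interval e ℓ) (sym (+-suc c m))) ⟩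
  interval c (suc m) ++ interval (c + suc m) ℓ      ∎
  where open ≡-Reasoning

interval-2 : ∀ e → interval e 2 ≡ e ∷ suc e ∷ []
interval-2 e = trans (interval-∷ e 1) (cong (e ∷_) (interval-∷ (suc e) 0))

-- The end `c + ℓ` is exclusive. With both ends odd, the cuts fall between pairs and never inside
-- one.
odd-ends⇒closed : Odd c → Odd (c + ℓ) → Closed (interval c ℓ)
odd-ends⇒closed oc oe x∈ x⋈y with ∈-interval⁻ x∈ | x⋈y
... | c≤x , x<e | up ox   = ∈-interval⁺ (m≤n⇒m≤1+n c≤x) (odd-gap ox oe x<e)
... | c≤x , x<e | down {y} oy =
  ∈-interval⁺ (s≤s⁻¹ (≤∧≢⇒< c≤x λ { refl → odd⇒¬even (suc y) oc (odd-suc y oy) }))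
              (<-trans (n<1+n _) x<e)

-- The partner of an even first letter would lie just before the interval, and that of an odd last
-- letter just after it.
closed⇒odd-ends : 1 ≤ c → 1 ≤ ℓ → Closed (interval c ℓ) → Odd c × Odd (c + ℓ)
closed⇒odd-ends {suc c} {suc ℓ} _ 1≤ℓ closed = odd-start , odd-end
  where
  odd-start : Odd (suc c)
  odd-start with parity c in eq
  ... | 0ℙ = even-suc c eq
  ... | 1ℙ = contradiction (proj₁ (∈-interval⁻ (closed (start∈ 1≤ℓ) (down eq)))) 1+n≰n
  odd-end : Odd (suc c + suc ℓ)
  -- Here `c` and `ℓ` are predecessors: the last letter is `suc (c + ℓ)`, and the exclusive end is
  -- two above `c + ℓ`, hence of the same parity.
  odd-end rewrite +-suc c ℓ with parity (c + ℓ) in eq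
  ... | 1ℙ = refl
  ... | 0ℙ = contradiction
    (proj₂ (∈-interval⁻ {c = suc c} {suc ℓ} (closed last∈ (up (even-suc (c + ℓ) eq)))))
    (<-irrefl (cong suc (sym (+-suc c ℓ))))
    where
    last∈ : suc (c + ℓ) ∈ interval (suc c) (suc ℓ)
    last∈ = ∈-interval⁺ (s≤s (m≤m+n c ℓ)) (s≤s (≤-reflexive (sym (+-suc c ℓ))))

fixed-interval : Odd c → Odd (c + ℓ) → 1 ≤ ℓ → interval c ℓ ⊆ a →
                 FixedInterval a (interval c ℓ)
fixed-interval {c} {ℓ} oc oe 1≤ℓ I⊆a = record
  { isInterval = c , ℓ , refl
  ; nonempty   = λ eq → case subst (c ∈_) eq (start∈ 1≤ℓ) of λ ()
  ; contained  = I⊆a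
  ; fixed      = closed⇒fixed
      (All.tabulate λ x∈ → ≤-trans (odd⇒≥1 oc) (proj₁ (∈-interval⁻ x∈)))
      (odd-ends⇒closed oc oe)
  }

-- Maximal fixed intervals described locally.

-- Maximality is tested only against the pairs directly after and directly before the interval.
-- Writing `c ≡ 2 + d` avoids truncated subtraction and makes `left-full` vacuous for `c = 1`,
-- before which there is no pair of letters.
record Block (a : Word) (c ℓ : ℕ) : Set where
  field
    start-odd  : Odd c
    len-even   : Even ℓ
    len≥2      : 2 ≤ ℓ
    contained  : interval c ℓ ⊆ a
    right-full : ¬ (c + ℓ ∈ a × suc (c + ℓ) ∈ a)
    left-full  : ∀ {d} → c ≡ 2 + d → ¬ (d ∈ a × suc d ∈ a)

  len≥1 : 1 ≤ ℓ
  len≥1 = ≤-trans (s≤s z≤n) len≥2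

  end-odd : Odd (c + ℓ)
  end-odd = odd+even c ℓ start-odd len-even

  closed : Closed (interval c ℓ)
  closed = odd-ends⇒closed start-odd end-odd

  start∈a : c ∈ a
  start∈a = contained (start∈ len≥1)

  suc-start∈a : suc c ∈ a
  suc-start∈a = contained (closed (start∈ len≥1) (up start-odd))

-- A fixed interval `J` containing the block has odd ends too, so if it sticks out on one side it
-- contains the whole adjacent pair there, which the block forbids.
block⇒maximal : All (1 ≤_) a → Block a c ℓ → MaximalFixedInterval a (interval c ℓ)
block⇒maximal {a} {c} {ℓ} pos B = record
  { fixedInterval = fixed-interval start-odd end-odd len≥1 contained
  ; maximal       = maximal
  }
  where
  open Block B
  maximal : ∀ J → FixedInterval a J → interval c ℓ ⊆ J → J ⊆ interval c ℓ
  maximal _ F I⊆J {x} x∈J with FixedInterval.isInterval F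
  ... | d , zero      , refl = contradiction refl (FixedInterval.nonempty F)
  ... | d , m@(suc _) , refl = ∈-interval⁺ (≮⇒≥ x≮c) (≰⇒> e≰x)
    where
    J⊆a = FixedInterval.contained F
    odd-ends : Odd d × Odd (d + m)
    odd-ends = closed⇒odd-ends (All.lookup pos (J⊆a (start∈ z<s))) z<s
                 (fixed⇒closed (FixedInterval.fixed F))
    c∈J : d ≤ c × c < d + m
    c∈J = ∈-interval⁻ (I⊆J (start∈ len≥1))
    x-bounds : d ≤ x × x < d + m
    x-bounds = ∈-interval⁻ x∈J
    x≮c : ¬ x < c
    x≮c x<c = lemma start-odd refl
      where
      1+d<c : suc d < c
      1+d<c = odd-gap (proj₁ odd-ends) start-odd (≤-<-trans (proj₁ x-bounds) x<c)
      -- The start is replaced by a variable `e` in order to split it: either it is 1, leaving no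
      -- room for `d` below, or it is `2 + d′` and the pair `d′`, `suc d′` lies in `J`.
      lemma : ∀ {e} → Odd e → ¬ e ≡ c
      lemma {suc zero}    _ refl = contradiction 1+d<c λ { (s≤s ()) }
      lemma {suc (suc d′)} _ refl = left-full refl
        ( J⊆a (∈-interval⁺ d≤d′ (<-trans (n<1+n _) 1+d′<))
        , J⊆a (∈-interval⁺ (m≤n⇒m≤1+n d≤d′) 1+d′<))
        where
        d≤d′ : d ≤ d′
        d≤d′ = s≤s⁻¹ (s≤s⁻¹ 1+d<c)
        1+d′< : suc d′ < d + m
        1+d′< = <-trans (n<1+n _) (proj₂ c∈J)
    e≰x : ¬ c + ℓ ≤ x
    e≰x e≤x = right-full
      ( J⊆a (∈-interval⁺ d≤e e<)
      , J⊆a (∈-interval⁺ (m≤n⇒m≤1+n d≤e) (odd-gap end-odd (proj₂ odd-ends) e<)))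
      where
      d≤e : d ≤ c + ℓ
      d≤e = ≤-trans (proj₁ c∈J) (m≤m+n c ℓ)
      e< : c + ℓ < d + m
      e< = ≤-<-trans e≤x (proj₂ x-bounds)

++-⊆ : ∀ {u v : Word} → u ⊆ a → v ⊆ a → u ++ v ⊆ a
++-⊆ {u = u} u⊆a v⊆a = [ u⊆a , v⊆a ]′ ∘ ∈-++⁻ u

pair-⊆ : x ∈ a → suc x ∈ a → interval x 2 ⊆ a
pair-⊆ {x} x∈a 1+x∈a rewrite interval-2 x = λ
  { (here refl) → x∈a ; (there (here refl)) → 1+x∈a }

-- Gluing a complete adjacent pair to the interval would give a larger fixed interval inside `a`.
maximal⇒block : Odd c → Even ℓ → 2 ≤ ℓ →
                MaximalFixedInterval a (interval c ℓ) → Block a c ℓ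
maximal⇒block {c} {ℓ} {a} oc eℓ 2≤ℓ M = record
  { start-odd  = oc
  ; len-even   = eℓ
  ; len≥2      = 2≤ℓ
  ; contained  = contained
  ; right-full = right-full
  ; left-full  = left-full
  }
  where
  open MaximalFixedInterval M
  open FixedInterval fixedInterval using (contained)
  right-full : ¬ (c + ℓ ∈ a × suc (c + ℓ) ∈ a)
  right-full (e∈a , 1+e∈a) = <-irrefl refl (proj₂ (∈-interval⁻ {c = c} e∈I))
    where
    J≡ : interval c (ℓ + 2) ≡ interval c ℓ ++ interval (c + ℓ) 2
    J≡ = interval-++ c ℓ 2
    J-fixed : FixedInterval a (interval c (ℓ + 2))
    J-fixed = fixed-interval oc (odd+even c (ℓ + 2) oc (trans (cong parity (+-comm ℓ 2)) eℓ))
      (≤-trans (s≤s z≤n) (m≤n+m 2 ℓ))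
      (subst (_⊆ a) (sym J≡) (++-⊆ contained (pair-⊆ e∈a 1+e∈a)))
    e∈I : c + ℓ ∈ interval c ℓ
    e∈I = maximal _ J-fixed
      (⊆-reflexive (sym J≡) ∘ ∈-++⁺ˡ)
      (⊆-reflexive (sym J≡) (∈-++⁺ʳ (interval c ℓ) (start∈ (s≤s z≤n))))
  left-full : ∀ {d} → c ≡ 2 + d → ¬ (d ∈ a × suc d ∈ a)
  left-full {d} refl (d∈a , 1+d∈a) =
    1+n≰n (<-trans (n<1+n _) (proj₁ (∈-interval⁻ {c = 2 + d} d∈I)))
    where
    J≡ : interval d (2 + ℓ) ≡ interval d 2 ++ interval (2 + d) ℓ
    J≡ = trans (interval-++ d 2 ℓ)
               (cong (λ e → interval d 2 ++ interval e ℓ) (+-comm d 2))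
    J-fixed : FixedInterval a (interval d (2 + ℓ))
    J-fixed = fixed-interval oc (odd+even d (2 + ℓ) oc eℓ) (s≤s z≤n)
      (subst (_⊆ a) (sym J≡) (++-⊆ (pair-⊆ d∈a 1+d∈a) contained))
    d∈I : d ∈ interval (2 + d) ℓ
    d∈I = maximal _ J-fixed
      (⊆-reflexive (sym J≡) ∘ ∈-++⁺ʳ (interval d 2))
      (start∈ (s≤s z≤n))

-- Words cut into gaps and blocks.

intervals : ∀ {k} → Vector ℕ k → Vector ℕ k → Vector Word k
intervals start len i = interval (start i) (len i)

X⊆interleave : ∀ {k} (X : Vector Word (suc k)) A i → X i ⊆ interleave X A
X⊆interleave {zero}  X A zero    x∈ = x∈
X⊆interleave {suc k} X A zero    x∈ = ∈-++⁺ˡ x∈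
X⊆interleave {suc k} X A (suc i) x∈ =
  ∈-++⁺ʳ (head X) (∈-++⁺ʳ (head A) (X⊆interleave (tail X) (tail A) i x∈))

A⊆interleave : ∀ {k} (X : Vector Word (suc k)) A i → A i ⊆ interleave X A
A⊆interleave {suc k} X A zero    x∈ = ∈-++⁺ʳ (head X) (∈-++⁺ˡ x∈)
A⊆interleave {suc k} X A (suc i) x∈ =
  ∈-++⁺ʳ (head X) (∈-++⁺ʳ (head A) (A⊆interleave (tail X) (tail A) i x∈))

∈-interleave⁻ : ∀ {k} (X : Vector Word (suc k)) A → x ∈ interleave X A →
                (∃ λ i → x ∈ X i) ⊎ (∃ λ i → x ∈ A i)
∈-interleave⁻ {k = zero}  X A x∈ = inj₁ (zero , x∈)
∈-interleave⁻ {k = suc k} X A x∈ with ∈-++⁻ (head X) x∈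
... | inj₁ x∈X = inj₁ (zero , x∈X)
... | inj₂ x∈′ with ∈-++⁻ (head A) x∈′
...   | inj₁ x∈A = inj₂ (zero , x∈A)
...   | inj₂ x∈″ with ∈-interleave⁻ (tail X) (tail A) x∈″
...     | inj₁ (i , x∈X) = inj₁ (suc i , x∈X)
...     | inj₂ (i , x∈A) = inj₂ (suc i , x∈A)

interleave-∷ : ∀ {k} x (X : Vector Word (suc k)) A →
               interleave ((x ∷ head X) Vector.∷ tail X) A ≡ x ∷ interleave X A
interleave-∷ {zero}  x X A = refl
interleave-∷ {suc k} x X A = refl

∈-concat-tabulate⁺ : ∀ {k} (Y : Vector Word k) i → Y i ⊆ concat (tabulate Y)
∈-concat-tabulate⁺ Y i x∈ = ∈-concat⁺′ x∈ (∈-tabulate⁺ {f = Y} i)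

∈-concat-tabulate⁻ : ∀ {k} (Y : Vector Word k) → x ∈ concat (tabulate Y) → ∃ λ i → x ∈ Y i
∈-concat-tabulate⁻ Y x∈
  with _ , x∈Yi , Yi∈ ← ∈-concat⁻′ (tabulate Y) x∈
  with i , refl ← ∈-tabulate⁻ {f = Y} Yi∈ = i , x∈Yi

-- The ambient word `a` is kept apart from the gaps and blocks, so that dropping the first gap and
-- block leaves all conditions relative to the whole of `a`. This is what the inductions over the
-- blocks need.
record Parse (a : Word) {k} (X : Vector Word (suc k)) (start len : Vector ℕ k) : Set where
  field
    lone  : ∀ i {x y} → x ∈ X i → y ∈ a → ¬ x ⋈ y
    block : ∀ i → Block a (start i) (len i)

Parse-tail : ∀ {k} {X : Vector Word (suc (suc k))} {start len} →
             Parse a X start len → Parse a (tail X) (tail start) (tail len)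
Parse-tail P = record { lone = λ i → lone (suc i) ; block = λ i → block (suc i) }
  where open Parse P

record Parsing (w : Word) : Set where
  field
    k          : ℕ
    X          : Vector Word (suc k)
    start len  : Vector ℕ k
    decomposes : w ≡ interleave X (intervals start len)
    parsed     : Parse w X start len

  open Parse parsed public

  X⊆w : ∀ i → X i ⊆ w
  X⊆w i x∈ rewrite decomposes = X⊆interleave X (intervals start len) i x∈

parse-[] : Parsing []
parse-[] = record
  { k = 0 ; X = λ _ → [] ; start = λ () ; len = λ ()
  ; decomposes = refl
  ; parsed = record { lone = λ _ () ; block = λ () }
  }

-- A new least letter can complete a pair only as its odd member. With that excluded it joins the
-- first gap, old gap letters gain no partner and old blocks gain no adjacent pair.
cons-lone : All (x <_) w → ¬ (Odd x × suc x ∈ w) → Parsing w → Parsing (x ∷ w)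
cons-lone {x} {w} x<w unpaired P = record
  { k = k ; X = X′ ; start = start ; len = len
  ; decomposes = trans (cong (x ∷_) decomposes) (sym (interleave-∷ x X (intervals start len)))
  ; parsed = record { lone = lone′ ; block = λ i → block-∷ (block i) }
  }
  where
  open Parsing P
  X′ = (x ∷ head X) Vector.∷ tail X

  x-lone : y ∈ w → ¬ x ⋈ y
  x-lone y∈w (up ox)  = unpaired (ox , y∈w)
  x-lone y∈w (down _) = <-asym (All.lookup x<w y∈w) (n<1+n _)

  lone-∷ : ∀ {y z} → y ∈ w → (∀ {z} → z ∈ w → ¬ y ⋈ z) → z ∈ x ∷ w → ¬ y ⋈ z
  lone-∷ y∈w y-lone (here refl) = x-lone y∈w ∘ ⋈-sym
  lone-∷ y∈w y-lone (there z∈w) = y-lone z∈w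

  lone′ : ∀ i {y z} → y ∈ X′ i → z ∈ x ∷ w → ¬ y ⋈ z
  lone′ zero    (here refl) (here z≡x)  = λ { (up _) → 1+n≢n z≡x ; (down _) → 1+n≢n (sym z≡x) }
  lone′ zero    (here refl) (there z∈w) = x-lone z∈w
  lone′ zero    (there y∈)  z∈          = lone-∷ (X⊆w zero y∈) (lone zero y∈) z∈
  lone′ (suc i) y∈          z∈          = lone-∷ (X⊆w (suc i) y∈) (lone (suc i) y∈) z∈

  block-∷ : Block w c ℓ → Block (x ∷ w) c ℓ
  block-∷ {c} {ℓ} B = record
    { start-odd  = start-odd
    ; len-even   = len-even
    ; len≥2      = len≥2
    ; contained  = there ∘ contained
    ; right-full = λ (e∈ , 1+e∈) →
        right-full (above ≤-refl e∈ , above (n≤1+n _) 1+e∈)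
    ; left-full  = left
    }
    where
    open Block B
    above : ∀ {z} → c + ℓ ≤ z → z ∈ x ∷ w → z ∈ w
    above e≤x (here refl) = contradiction
      (≤-trans (m≤m+n c ℓ) e≤x) (<⇒≱ (All.lookup x<w start∈a))
    above e≤z (there z∈w) = z∈w
    left : ∀ {d} → c ≡ 2 + d → ¬ (d ∈ x ∷ w × suc d ∈ x ∷ w)
    left eq (there d∈w  , there 1+d∈w) = left-full eq (d∈w , 1+d∈w)
    left eq (here refl  , here 1+d≡d)  = 1+n≢n 1+d≡d
    -- The only candidate for a new pair before `c`: then `x` is `d`, which is odd because `c` is.
    left eq (here refl  , there 1+d∈w) = unpaired (trans (sym (cong parity eq)) start-odd , 1+d∈w)
    left eq (there d∈w  , here refl)   = <-asym (All.lookup x<w d∈w) (n<1+n _)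

-- The missing pair in `gap` serves twice: it makes the new block maximal on the right, and it
-- prevents the next block from starting directly after it, which keeps that block maximal on the
-- left.
cons-block : Odd c → Even ℓ → 2 ≤ ℓ → All (c + ℓ ≤_) w →
             ¬ (c + ℓ ∈ w × suc (c + ℓ) ∈ w) → Parsing w → Parsing (interval c ℓ ++ w)
cons-block {c} {ℓ} {w} oc eℓ 2≤ℓ e≤w gap P = record
  { k = suc k ; X = [] Vector.∷ X ; start = c Vector.∷ start ; len = ℓ Vector.∷ len
  ; decomposes = cong (interval c ℓ ++_) decomposes
  ; parsed = record { lone = lone′ ; block = λ { zero → first ; (suc i) → later (block i) } }
  }
  where
  open Parsing P
  I = interval c ℓ

  oe : Odd (c + ℓ)
  oe = odd+even c ℓ oc eℓ

  below : ∀ {z} → z ∈ I → z < c + ℓ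
  below = proj₂ ∘ ∈-interval⁻

  disjoint : ∀ {z} → z ∈ I → z ∉ w
  disjoint z∈I z∈w = <⇒≱ (below z∈I) (All.lookup e≤w z∈w)

  above : ∀ {z} → c + ℓ ≤ z → z ∈ I ++ w → z ∈ w
  above e≤z z∈ with ∈-++⁻ I z∈
  ... | inj₁ z∈I = contradiction e≤z (<⇒≱ (below z∈I))
  ... | inj₂ z∈w = z∈w

  lone′ : ∀ i {x y} → x ∈ ([] Vector.∷ X) i → y ∈ I ++ w → ¬ x ⋈ y
  lone′ (suc i) x∈ y∈ x⋈y with ∈-++⁻ I y∈
  ... | inj₁ y∈I = disjoint (odd-ends⇒closed oc oe y∈I (⋈-sym x⋈y)) (X⊆w i x∈)
  ... | inj₂ y∈w = lone i x∈ y∈w x⋈y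

  first : Block (I ++ w) c ℓ
  first = record
    { start-odd  = oc
    ; len-even   = eℓ
    ; len≥2      = 2≤ℓ
    ; contained  = ∈-++⁺ˡ
    ; right-full = λ (e∈ , 1+e∈) → gap (above ≤-refl e∈ , above (n≤1+n _) 1+e∈)
    ; left-full  = left
    }
    where
    left : ∀ {d} → c ≡ 2 + d → ¬ (d ∈ I ++ w × suc d ∈ I ++ w)
    left {d} refl (d∈ , _) with ∈-++⁻ I d∈
    ... | inj₁ d∈I = 1+n≰n (<-trans (n<1+n _) (proj₁ (∈-interval⁻ {c = c} d∈I)))
    ... | inj₂ d∈w = 1+n≰n (<-trans (n<1+n _) (≤-trans (m≤m+n c ℓ) (All.lookup e≤w d∈w)))

  later : ∀ {c′ ℓ′} → Block w c′ ℓ′ → Block (I ++ w) c′ ℓ′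
  later {c′} {ℓ′} B = record
    { start-odd  = start-odd
    ; len-even   = len-even
    ; len≥2      = len≥2
    ; contained  = ∈-++⁺ʳ I ∘ contained
    ; right-full = λ (e∈ , 1+e∈) →
        right-full (above e≤e′ e∈ , above (m≤n⇒m≤1+n e≤e′) 1+e∈)
    ; left-full  = left
    }
    where
    open Block B
    e≤c′ : c + ℓ ≤ c′
    e≤c′ = All.lookup e≤w start∈a
    e≤e′ : c + ℓ ≤ c′ + ℓ′
    e≤e′ = ≤-trans e≤c′ (m≤m+n c′ ℓ′)
    left : ∀ {d} → c′ ≡ 2 + d → ¬ (d ∈ I ++ w × suc d ∈ I ++ w)
    left {d} refl (d∈ , 1+d∈) with ∈-++⁻ I d∈
    ... | inj₂ d∈w = left-full refl (d∈w , above (m≤n⇒m≤1+n (All.lookup e≤w d∈w)) 1+d∈)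
    -- By parity `d < c + ℓ` gives `2 + d ≤ c + ℓ`, so the later block would start exactly at
    -- `c + ℓ`, and its first pair is the one excluded by `gap`.
    ... | inj₁ d∈I = gap (subst (_∈ w) c′≡e start∈a , subst (_∈ w) (cong suc c′≡e) suc-start∈a)
      where
      c′≡e : c′ ≡ c + ℓ
      c′≡e = ≤-antisym (odd-gap {d} start-odd oe (below d∈I)) e≤c′

-- Sorted words and the reading from left to right.

Sorted : Word → Set
Sorted = AllPairs _<_

sorted-++⁻ˡ : ∀ u {v} → Sorted (u ++ v) → Sorted u
sorted-++⁻ˡ []      _         = []
sorted-++⁻ˡ (x ∷ u) (x< ∷ st) = All.++⁻ˡ u x< ∷ sorted-++⁻ˡ u st

sorted-++⁻ʳ : ∀ u {v} → Sorted (u ++ v) → Sorted v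
sorted-++⁻ʳ []      st       = st
sorted-++⁻ʳ (x ∷ u) (_ ∷ st) = sorted-++⁻ʳ u st

sorted-++⇒< : ∀ u {v} → Sorted (u ++ v) → x ∈ u → y ∈ v → x < y
sorted-++⇒< (x ∷ u) (x< ∷ _) (here refl) y∈v = All.lookup (All.++⁻ʳ u x<) y∈v
sorted-++⇒< (x ∷ u) (_ ∷ st) (there x∈u) y∈v = sorted-++⇒< u st x∈u y∈v

least-first : All (x ≤_) w → Sorted w → x ∈ w → ∃ λ v → w ≡ x ∷ v
least-first _         _        (here refl) = _ , refl
least-first (x≤y ∷ _) (y< ∷ _) (there x∈w) = contradiction x≤y (<⇒≱ (All.lookup y< x∈w))

-- By sortedness `x` and `suc x` could only be the first two letters, so looking two letters ahead
-- decides whether a block can be prolonged.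
no-pair : All (x ≤_) w → Sorted w → (∀ {v} → w ≢ x ∷ suc x ∷ v) → ¬ (x ∈ w × suc x ∈ w)
no-pair x≤w st ≢ (x∈w , 1+x∈w) with _ , refl ← least-first x≤w st x∈w | 1+x∈w | st
... | here 1+x≡x | _        = 1+n≢n 1+x≡x
... | there 1+x∈v | x<v ∷ st′ with _ , refl ← least-first x<v st′ 1+x∈v = ≢ refl

mutual
  -- Only an odd letter can have its partner to the right, and in a sorted word that partner must
  -- come next. Such a pair opens a block of length 2; any other first letter goes to a gap.
  parse : ∀ w → Sorted w → Parsing w
  parse []          _        = parse-[]
  parse (x ∷ [])    _        = cons-lone [] (λ ()) parse-[]
  parse (x ∷ y ∷ w) (x<yw@(x<y ∷ _) ∷ st@(y<w ∷ st′))
    with (parity x ℙ.≟ 1ℙ) ×-dec (y ≟ suc x) | parse (y ∷ w) st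
  ... | yes (ox , refl) | _ = subst Parsing (cong (_++ w) (interval-2 x))
      (grow x 2 ox refl ≤-refl w st′ (subst (λ e → All (e ≤_) w) (+-comm 2 x) y<w))
  ... | no ¬pair | P = cons-lone x<yw unpaired P
    where
    unpaired : ¬ (Odd x × suc x ∈ y ∷ w)
    unpaired (ox , 1+x∈) with _ , refl ← least-first x<yw st 1+x∈ = ¬pair (ox , refl)

  -- An open block absorbs the pair directly after it as long as that pair is present; it is closed
  -- only when the pair is missing, which yields the gap required by `cons-block`.
  grow : ∀ c ℓ → Odd c → Even ℓ → 2 ≤ ℓ → ∀ w → Sorted w → All (c + ℓ ≤_) w →
         Parsing (interval c ℓ ++ w)
  grow c ℓ oc eℓ 2≤ℓ [] st e≤w = cons-block oc eℓ 2≤ℓ e≤w (λ ()) (parse [] st)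
  grow c ℓ oc eℓ 2≤ℓ w@(_ ∷ []) st e≤w =
    cons-block oc eℓ 2≤ℓ e≤w (no-pair e≤w st λ ()) (parse w st)
  grow c ℓ oc eℓ 2≤ℓ w@(y ∷ z ∷ v) st@(y< ∷ z<v ∷ st′) e≤w
    with (y ≟ c + ℓ) ×-dec (z ≟ suc (c + ℓ)) | parse w st
  ... | yes (refl , refl) | _ = subst Parsing eq
      (grow c (ℓ + 2) oc (trans (cong parity (+-comm ℓ 2)) eℓ) (m≤n+m 2 ℓ) v st′
        (subst (λ e → All (e ≤_) v) (trans (+-comm 2 (c + ℓ)) (+-assoc c ℓ 2)) z<v))
    where
    eq : interval c (ℓ + 2) ++ v ≡ interval c ℓ ++ w
    eq = begin
      interval c (ℓ + 2) ++ v                      ≡⟨ cong (_++ v) (interval-++ c ℓ 2) ⟩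
      (interval c ℓ ++ interval (c + ℓ) 2) ++ v    ≡⟨ ++-assoc (interval c ℓ) _ v ⟩
      interval c ℓ ++ (interval (c + ℓ) 2 ++ v)    ≡⟨ cong (λ u → interval c ℓ ++ (u ++ v)) (interval-2 (c + ℓ)) ⟩
      interval c ℓ ++ w                            ∎
      where open ≡-Reasoning
  ... | no ¬pair | P = cons-block oc eℓ 2≤ℓ e≤w
      (no-pair e≤w st λ { refl → ¬pair (refl , refl) }) P

-- The symplectic bound along a word.

-- IsSymplectic for a suffix that is preceded by m letters.
data Bounded (m : ℕ) : Word → Set where
  []  : Bounded m []
  _∷_ : 2 * m < x → Bounded (suc m) w → Bounded m (x ∷ w)

bounded⁺ : ∀ m w → (∀ j → 2 * (m + toℕ j) < lookup w j) → Bounded m w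
bounded⁺ m []      f = []
bounded⁺ m (x ∷ w) f = subst (λ i → 2 * i < x) (+-identityʳ m) (f zero) ∷
  bounded⁺ (suc m) w (λ j → subst (λ i → 2 * i < lookup w j) (+-suc m (toℕ j)) (f (suc j)))

bounded⁻ : ∀ {m w} → Bounded m w → ∀ j → 2 * (m + toℕ j) < lookup w j
bounded⁻ {m} {x ∷ w} (b ∷ _)  zero    = subst (λ i → 2 * i < x) (sym (+-identityʳ m)) b
bounded⁻ {m} {x ∷ w} (_ ∷ bs) (suc j) =
  subst (λ i → 2 * i < lookup w j) (sym (+-suc m (toℕ j))) (bounded⁻ bs j)

-- With the zero-based position m = k - 1, the bound 2k - 1 ≤ b turns into the strict inequality 2m
-- < b.
2[1+m]∸1 : ∀ m → 2 * suc m ∸ 1 ≡ suc (2 * m)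
2[1+m]∸1 m = +-suc m (m + 0)

bounded-++⁺ : ∀ u {v m} → Bounded m u → Bounded (length u + m) v → Bounded m (u ++ v)
bounded-++⁺ []      []       bv = bv
bounded-++⁺ (x ∷ u) {v} {m} (b ∷ bu) bv =
  b ∷ bounded-++⁺ u bu (subst (λ i → Bounded i v) (sym (+-suc (length u) m)) bv)

bounded-++⁻ʳ : ∀ u {v m} → Bounded m (u ++ v) → Bounded (length u + m) v
bounded-++⁻ʳ []      b = b
bounded-++⁻ʳ (x ∷ u) {v} {m} (_ ∷ b) =
  subst (λ i → Bounded i v) (+-suc (length u) m) (bounded-++⁻ʳ u b)

2[1+m]+ℓ : ∀ m ℓ → 2 * suc m + ℓ ≡ suc (2 * m + suc ℓ)
2[1+m]+ℓ = solve-∀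

-- Along a run the letters rise by 1 and the bound by 2, so the last letter is the critical one: c +
-- ℓ - 1 > 2(m + ℓ - 1) amounts to c ≥ 2m + ℓ.
bounded-interval⁺ : ∀ m c ℓ → 2 * m + ℓ ≤ c → Bounded m (interval c ℓ)
bounded-interval⁺ m c zero    _ = []
bounded-interval⁺ m c (suc ℓ) h rewrite interval-∷ c ℓ =
  <-≤-trans (m<m+n (2 * m) z<s) h ∷
  bounded-interval⁺ (suc m) (suc c) ℓ (≤-trans (≤-reflexive (2[1+m]+ℓ m ℓ)) (s≤s h))

bounded-interval⁻ : ∀ m c ℓ {w} → 1 ≤ ℓ → Bounded m (interval c ℓ ++ w) → 2 * m + ℓ ≤ c
bounded-interval⁻ m c (suc ℓ) {w} _ b
  with ℓ | subst (λ u → Bounded m (u ++ w)) (interval-∷ c ℓ) b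
... | zero   | 2m<c ∷ _ = ≤-trans (≤-reflexive (+-comm (2 * m) 1)) 2m<c
... | suc ℓ′ | _ ∷ b′   = s≤s⁻¹ (≤-trans (≤-reflexive (sym (2[1+m]+ℓ m (suc ℓ′))))
  (bounded-interval⁻ (suc m) (suc c) (suc ℓ′) z<s b′))

-- The last letter exceeds twice the number of letters before it and is at most 2n. The word is
-- nonempty because an empty one would say nothing about `m`.
bounded⇒length≤ : ∀ {m n x w} → Bounded m (x ∷ w) → All (_≤ 2 * n) (x ∷ w) →
                  m + length (x ∷ w) ≤ n
bounded⇒length≤ {m} {n} {w = []}    (2m<x ∷ _) (x≤2n ∷ _) =
  subst (_≤ n) (+-comm 1 m) (*-cancelˡ-< 2 m n (<-≤-trans 2m<x x≤2n))
bounded⇒length≤ {m} {n} {w = y ∷ w} (_ ∷ b) (_ ∷ ≤2n) =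
  subst (_≤ n) (sym (+-suc m (suc (length w)))) (bounded⇒length≤ b ≤2n)

-- Block starts and the symplectic bound.

-- The count t⁽ⁱ⁻¹⁾ of the decomposition, detached from the record so that inductions can pass to
-- tails.
before : ∀ {k} → Vector Word (suc k) → Vector ℕ k → Fin k → ℕ
before X len i = ∑[ j < toℕ i ] len (inject {i = i} j)
               + ∑[ j ≤ toℕ i ] length (X (inject {i = suc i} j))

-- The offset after one more gap and block, bracketed as two uses of `bounded-++⁻ʳ` produce it.
past-first : ∀ {k} → Vector Word (suc (suc k)) → Vector ℕ (suc k) → ℕ → ℕ
past-first X len m = head len + (length (head X) + m)

before-zero : ∀ {k} (X : Vector Word (suc (suc k))) (len : Vector ℕ (suc k)) m →
              m + before X len zero ≡ length (head X) + m
before-zero X len m = trans (cong (λ e → m + e) (+-identityʳ _)) (+-comm m _)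

before-suc : ∀ {k} (X : Vector Word (suc (suc k))) (len : Vector ℕ (suc k)) m i →
             m + before X len (suc i) ≡ past-first X len m + before (tail X) (tail len) i
before-suc X len m i = rearrange m (head len) _ (length (head X)) _
  where
  rearrange : ∀ m l L p Q → m + ((l + L) + (p + Q)) ≡ (l + (p + m)) + (L + Q)
  rearrange = solve-∀

length-interleave : ∀ {k} (X : Vector Word (suc k)) start len →
  length (interleave X (intervals start len)) ≡ ∑[ i < k ] len i + ∑[ i ≤ k ] length (X i)
length-interleave {zero}  X start len = sym (+-identityʳ _)
length-interleave {suc k} X start len = begin
  length (X₀ ++ A₀ ++ rest)                ≡⟨ length-++ X₀ ⟩
  length X₀ + length (A₀ ++ rest)          ≡⟨ cong (λ l → length X₀ + l) (length-++ A₀) ⟩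
  length X₀ + (length A₀ + length rest)    ≡⟨ cong (λ l → length X₀ + (l + length rest))
                                                (length-applyUpTo (λ i → head start + i) (head len)) ⟩
  length X₀ + (head len + length rest)     ≡⟨ cong (λ r → length X₀ + (head len + r))
                                                (length-interleave (tail X) (tail start) (tail len)) ⟩
  length X₀ + (head len + (L + Q))         ≡⟨ rearrange (length X₀) (head len) L Q ⟩
  (head len + L) + (length X₀ + Q)         ∎
  where
  open ≡-Reasoning
  X₀ = head X
  A₀ = interval (head start) (head len)
  L = ∑[ i < k ] tail len i
  Q = ∑[ i ≤ k ] length (tail X i)
  rest = interleave (tail X) (intervals (tail start) (tail len))
  rearrange : ∀ p l L Q → p + (l + (L + Q)) ≡ (l + L) + (p + Q)
  rearrange = solve-∀

-- Stated for an arbitrary number `m` of letters already passed, since the induction removes one gap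
-- and one block at a time.
bounded⇒start≥ : ∀ {k} (X : Vector Word (suc k)) start len {m} → Parse a X start len →
  Bounded m (interleave X (intervals start len)) →
  ∀ i → start i ≥ 2 * (m + before X len i) + len i + 1
bounded⇒start≥ X start len {m} P b zero = begin
  2 * (m + before X len zero) + head len + 1   ≡⟨ cong (λ e → 2 * e + head len + 1) (before-zero X len m) ⟩
  2 * m₀ + head len + 1                        ≡⟨ +-comm _ 1 ⟩
  suc (2 * m₀ + head len)                      ≤⟨ ≤∧≢⇒< 2m₀+ℓ≤c (λ eq →
                                                    odd⇒¬even (head start) start-odd (subst Even eq even)) ⟩
  head start                                   ∎
  where
  open ≤-Reasoning hiding (start)
  open Block (Parse.block P zero)
  m₀ = length (head X) + m
  2m₀+ℓ≤c : 2 * m₀ + head len ≤ head start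
  2m₀+ℓ≤c = bounded-interval⁻ m₀ (head start) (head len) len≥1 (bounded-++⁻ʳ (head X) b)
  even : Even (2 * m₀ + head len)
  even = trans (ℙ.+-homo-+ (2 * m₀) (head len)) (cong₂ ℙ._+_ (even-double m₀) len-even)
bounded⇒start≥ X start len {m} P b (suc i) =
  subst (λ e → start (suc i) ≥ 2 * e + len (suc i) + 1) (sym (before-suc X len m i))
    (bounded⇒start≥ (tail X) (tail start) (tail len) (Parse-tail P)
      (subst (λ l → Bounded (l + (length (head X) + m)) rest)
        (length-applyUpTo (λ j → head start + j) (head len))
        (bounded-++⁻ʳ (interval (head start) (head len)) (bounded-++⁻ʳ (head X) b)))
      i)
  where
  rest = interleave (tail X) (intervals (tail start) (tail len))

-- Letters from different pairs {2j − 1, 2j} advance at least one pair per step.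
bounded-lone : ∀ u {v m} → Sorted (u ++ v) → All (2 * m <_) (u ++ v) →
  (∀ {x y} → x ∈ u → y ∈ u ++ v → ¬ x ⋈ y) →
  (All (2 * (length u + m) <_) v → Bounded (length u + m) v) → Bounded m (u ++ v)
bounded-lone []      st 2m<  lone rest = rest 2m<
bounded-lone (x ∷ u) {v} {m} (x< ∷ st) (2m<x ∷ _) lone rest =
  2m<x ∷ bounded-lone u st (All.tabulate 2[1+m]<) (λ x∈ y∈ → lone (there x∈) (there y∈))
    (subst (λ i → All (2 * i <_) v → Bounded i v) (sym (+-suc (length u) m)) rest)
  where
  2[1+m]< : ∀ {y} → y ∈ u ++ v → 2 * suc m < y
  -- From 2m < x < y follows y ≥ 2m + 2. Equality would force x = 2m + 1 and make `x` and `y`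
  -- partners.
  2[1+m]< {y} y∈ = subst (_< y) (sym (cong suc (+-suc m (m + 0))))
    (≤∧≢⇒< (≤-trans (s≤s 2m<x) x<y) λ { refl → partners (≤-antisym (s≤s⁻¹ x<y) 2m<x) refl })
    where
    x<y : x < y
    x<y = All.lookup x< y∈
    partners : x ≡ suc (2 * m) → ¬ y ≡ suc (suc (2 * m))
    partners refl refl = lone (here refl) (there y∈) (up (even-suc (2 * m) (even-double m)))

-- A gap needs only that its letters exceed `2 * m` at its start, and a block needs only its start
-- inequality. The induction carries the former across each block.
start≥⇒bounded : ∀ {k} (X : Vector Word (suc k)) start len {m} → Parse a X start len →
  (∀ i → start i ≥ 2 * (m + before X len i) + len i + 1) →
  let w = interleave X (intervals start len) in
  Sorted w → w ⊆ a → All (2 * m <_) w → Bounded m w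
start≥⇒bounded {k = zero}  X start len {m} P _ st w⊆a 2m< =
  subst (Bounded m) (++-identityʳ (head X))
    (bounded-lone (head X) (subst Sorted eq st) (subst (All (2 * m <_)) eq 2m<)
      (λ x∈ y∈ → Parse.lone P zero x∈ (w⊆a (subst (_ ∈_) (sym eq) y∈)))
      (λ _ → []))
  where
  eq : head X ≡ head X ++ []
  eq = sym (++-identityʳ (head X))
start≥⇒bounded {k = suc k} X start len {m} P start≥ st w⊆a 2m< =
  bounded-lone (head X) st 2m< (λ x∈ y∈ → Parse.lone P zero x∈ (w⊆a y∈)) λ _ →
    bounded-++⁺ A₀ (bounded-interval⁺ m₀ c₀ ℓ₀ (≤-trans (m≤m+n _ 1) c≥))
      (subst (λ l → Bounded (l + m₀) rest) (sym (length-applyUpTo (λ j → c₀ + j) ℓ₀))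
        (start≥⇒bounded (tail X) (tail start) (tail len) (Parse-tail P)
          (λ i → subst (λ e → start (suc i) ≥ 2 * e + len (suc i) + 1)
                   (before-suc X len m i) (start≥ (suc i)))
          (sorted-++⁻ʳ A₀ st′)
          (λ x∈ → w⊆a (∈-++⁺ʳ (head X) (∈-++⁺ʳ A₀ x∈)))
          (All.tabulate beyond)))
  where
  c₀ = head start
  ℓ₀ = head len
  A₀ = interval c₀ ℓ₀
  rest = interleave (tail X) (intervals (tail start) (tail len))
  m₀ = length (head X) + m
  c≥ : 2 * m₀ + ℓ₀ + 1 ≤ c₀
  c≥ = subst (λ e → 2 * e + ℓ₀ + 1 ≤ c₀) (before-zero X len m) (start≥ zero)
  st′ : Sorted (A₀ ++ rest)
  st′ = sorted-++⁻ʳ (head X) st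
  -- Adding the length to the start inequality puts the exclusive end of the block at 2(ℓ₀ + m₀) + 1
  -- or more; the `+ 1` in that inequality gives the strictness.
  beyond : ∀ {y} → y ∈ rest → 2 * (ℓ₀ + m₀) < y
  beyond {y} y∈ = begin-strict
    2 * (ℓ₀ + m₀)          <⟨ ≤-reflexive (rearrange m₀ ℓ₀) ⟩
    2 * m₀ + ℓ₀ + 1 + ℓ₀   ≤⟨ +-monoˡ-≤ ℓ₀ c≥ ⟩
    c₀ + ℓ₀                ≤⟨ ≮⇒≥ (λ y<e → <-irrefl refl (sorted-++⇒< A₀ st′ (∈-interval⁺ c≤y y<e) y∈)) ⟩
    y                      ∎
    where
    open ≤-Reasoning hiding (start)
    rearrange : ∀ m ℓ → suc (2 * (ℓ + m)) ≡ 2 * m + ℓ + 1 + ℓ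
    rearrange = solve-∀
    c≤y : c₀ ≤ y
    c≤y = <⇒≤ (sorted-++⇒< A₀ st′ (start∈ (Block.len≥1 (Parse.block P zero))) y∈)

-- Uniqueness of the blocks.

module _ {Q : ℕ → Set} where

  -- The first letter satisfying `Q` marks the cut. It is applied with `Q` meaning that a letter has
  -- its partner in `a`, which tells block letters from gap letters.
  split-unique : ∀ u u′ {v v′ x x′} → All (¬_ ∘ Q) u → All (¬_ ∘ Q) u′ → Q x → Q x′ →
                 u ++ x ∷ v ≡ u′ ++ x′ ∷ v′ → x ∷ v ≡ x′ ∷ v′
  split-unique []      []       _         _          _  _   eq = eq
  split-unique []      (_ ∷ u′) _         (¬q′ ∷ _)  q  _   eq =
    contradiction (subst Q (proj₁ (∷-injective eq)) q) ¬q′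
  split-unique (_ ∷ u) []       (¬q ∷ _)  _          _  q′  eq =
    contradiction (subst Q (sym (proj₁ (∷-injective eq))) q′) ¬q
  split-unique (_ ∷ u) (_ ∷ u′) (_ ∷ ¬qs) (_ ∷ ¬qs′) q  q′  eq =
    split-unique u u′ ¬qs ¬qs′ q q′ (proj₂ (∷-injective eq))

interval-head : ∀ c ℓ {w} → 1 ≤ ℓ → ∃ λ v → interval c ℓ ++ w ≡ c ∷ v
interval-head c (suc ℓ) {w} _ = _ , cong (_++ w) (interval-∷ c ℓ)

-- The longer block would contain the pair directly after the shorter one.
block-length-≮ : ∀ {ℓ ℓ′} → Block a c ℓ → Block a c ℓ′ → ¬ ℓ < ℓ′
block-length-≮ {c = c} {ℓ} B B′ ℓ<ℓ′ = Block.right-full B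
  ( Block.contained B′ (∈-interval⁺ c≤e e<e′)
  , Block.contained B′ (∈-interval⁺ (m≤n⇒m≤1+n c≤e)
      (odd-gap (Block.end-odd B) (Block.end-odd B′) e<e′)))
  where
  c≤e = m≤m+n c ℓ
  e<e′ = +-monoʳ-< c ℓ<ℓ′

block-unique : ∀ {c c′ ℓ ℓ′ v v′} → Block a c ℓ → Block a c′ ℓ′ →
  interval c ℓ ++ v ≡ interval c′ ℓ′ ++ v′ → c ≡ c′ × ℓ ≡ ℓ′ × v ≡ v′
block-unique {c = c} {c′} {ℓ} {ℓ′} B B′ eq
  with _ , e ← interval-head c ℓ (Block.len≥1 B) | _ , e′ ← interval-head c′ ℓ′ (Block.len≥1 B′)
  with refl ← proj₁ (∷-injective (trans (sym e) (trans eq e′)))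
  with refl ← ≤-antisym (≮⇒≥ (block-length-≮ B′ B)) (≮⇒≥ (block-length-≮ B B′))
  = refl , refl , ++-cancelˡ (interval c ℓ) _ _ eq

Paired : Word → ℕ → Set
Paired a x = ∃ λ y → y ∈ a × x ⋈ y

block-paired : Block a c ℓ → Paired a c
block-paired B = _ , suc-start∈a , up start-odd
  where open Block B

lone-gap : ∀ {k} {X : Vector Word (suc k)} {start len} → Parse a X start len →
           All (¬_ ∘ Paired a) (head X)
lone-gap P = All.tabulate λ x∈ (_ , y∈a , x⋈y) → Parse.lone P zero x∈ y∈a x⋈y

-- The first paired letter of the word is the start of the first block in both readings, so a gap
-- and a block can be removed from both at once. If one reading has no block left, its only gap
-- would have to contain a paired letter.
parse-unique : ∀ {k k′}
  (X : Vector Word (suc k)) start len (X′ : Vector Word (suc k′)) start′ len′ →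
  Parse a X start len → Parse a X′ start′ len′ →
  interleave X (intervals start len) ≡ interleave X′ (intervals start′ len′) →
  tabulate (intervals start len) ≡ tabulate (intervals start′ len′)
parse-unique {k = zero}  {zero}   X start len X′ start′ len′ P P′ eq = refl
parse-unique {k = zero}  {suc k′} X start len X′ start′ len′ P P′ eq = contradiction (up start-odd)
  (Parse.lone P zero (⊆-reflexive (sym eq) (∈-++⁺ʳ (head X′) (∈-++⁺ˡ (start∈ len≥1)))) suc-start∈a)
  where open Block (Parse.block P′ zero)
parse-unique {k = suc k} {zero}   X start len X′ start′ len′ P P′ eq = contradiction (up start-odd)
  (Parse.lone P′ zero (⊆-reflexive eq (∈-++⁺ʳ (head X) (∈-++⁺ˡ (start∈ len≥1)))) suc-start∈a)
  where open Block (Parse.block P zero)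
parse-unique {k = suc k} {suc k′} X start len X′ start′ len′ P P′ eq =
  let c≡c′ , ℓ≡ℓ′ , rest≡ = block-unique B B′ blocks≡ in
  cong₂ _∷_ (cong₂ interval c≡c′ ℓ≡ℓ′)
    (parse-unique (tail X) (tail start) (tail len) (tail X′) (tail start′) (tail len′)
      (Parse-tail P) (Parse-tail P′) rest≡)
  where
  B  = Parse.block P zero
  B′ = Parse.block P′ zero
  block-start : ∀ {c ℓ w} → Block _ c ℓ → ∃ λ v → interval c ℓ ++ w ≡ c ∷ v
  block-start B = interval-head _ _ (Block.len≥1 B)
  blocks≡ : interval (head start) (head len) ++ _ ≡ interval (head start′) (head len′) ++ _
  blocks≡ = let _ , e = block-start B ; _ , e′ = block-start B′ in
    trans e (trans
      (split-unique {Q = Paired _} (head X) (head X′) (lone-gap P) (lone-gap P′)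
        (block-paired B) (block-paired B′)
        (trans (cong (head X ++_) (sym e)) (trans eq (cong (head X′ ++_) e′))))
      (sym e′))

-- Disjoint blocks and the remaining subword.

gap-sorted : ∀ {k} (X : Vector Word (suc k)) A → Sorted (interleave X A) → ∀ i → Sorted (X i)
gap-sorted {zero}  X A st zero    = st
gap-sorted {suc k} X A st zero    = sorted-++⁻ˡ (head X) st
gap-sorted {suc k} X A st (suc i) =
  gap-sorted (tail X) (tail A) (sorted-++⁻ʳ (head A) (sorted-++⁻ʳ (head X) st)) i

blocks-disjoint : ∀ {k} (X : Vector Word (suc k)) A → Sorted (interleave X A) →
                  AllPairs Disjoint (tabulate A)
blocks-disjoint {zero}  X A st = []
blocks-disjoint {suc k} X A st =
  All.tabulate⁺ (λ i (x∈A₀ , x∈Aᵢ) →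
    <-irrefl refl (sorted-++⇒< (head A) st′ x∈A₀ (A⊆interleave (tail X) (tail A) i x∈Aᵢ)))
  ∷ blocks-disjoint (tail X) (tail A) (sorted-++⁻ʳ (head A) st′)
  where st′ = sorted-++⁻ʳ (head X) st

filter-interleave : ∀ {P : ℕ → Set} (P? : ∀ x → Dec (P x)) {k} (X : Vector Word (suc k)) A →
  (∀ i → All P (X i)) → (∀ i → All (¬_ ∘ P) (A i)) →
  filter P? (interleave X A) ≡ concat (tabulate X)
filter-interleave P? {zero}  X A pX ¬pA =
  trans (filter-all P? (pX zero)) (sym (++-identityʳ (head X)))
filter-interleave P? {suc k} X A pX ¬pA = begin
  filter P? (head X ++ head A ++ rest)                     ≡⟨ filter-++ P? (head X) _ ⟩
  filter P? (head X) ++ filter P? (head A ++ rest)         ≡⟨ cong₂ _++_ (filter-all P? (pX zero))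
                                                                (filter-++ P? (head A) rest) ⟩
  head X ++ filter P? (head A) ++ filter P? rest           ≡⟨ cong (λ u → head X ++ u ++ filter P? rest)
                                                                (filter-none P? (¬pA zero)) ⟩
  head X ++ filter P? rest                                 ≡⟨ cong (head X ++_) (filter-interleave P?
                                                                (tail X) (tail A) (pX ∘ suc) (¬pA ∘ suc)) ⟩
  concat (tabulate X)                                      ∎
  where
  open ≡-Reasoning
  rest = interleave (tail X) (tail A)

-- Transfer to columns and decompositions.

module _ {n t : ℕ} (𝐚 : Column n t) where
  open Column 𝐚

  sorted : Sorted word
  sorted = Linked⇒AllPairs <-trans increasing

  positive : All (1 ≤_) word
  positive = All.map proj₁ alphabet

  symplectic⇒bounded : IsSymplectic 𝐚 → Bounded 0 word
  symplectic⇒bounded sp =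
    bounded⁺ 0 word λ j → subst (_≤ lookup word j) (2[1+m]∸1 (toℕ j)) (sp j)

  bounded⇒symplectic : Bounded 0 word → IsSymplectic 𝐚
  bounded⇒symplectic b j = subst (_≤ lookup word j) (sym (2[1+m]∸1 (toℕ j))) (bounded⁻ b j)

  bounded⇒t≤n : Bounded 0 word → t ≤ n
  bounded⇒t≤n b = subst (_≤ n) length≡t (length≤n b (All.map proj₂ alphabet))
    where
    length≤n : ∀ {w} → Bounded 0 w → All (_≤ 2 * n) w → length w ≤ n
    length≤n []      _    = z≤n
    length≤n (b ∷ bs) ≤2n = bounded⇒length≤ (b ∷ bs) ≤2n

  symplectic⇒decomposition : 1 ≤ t → IsSymplectic 𝐚 → Decomposition 𝐚
  symplectic⇒decomposition 1≤t sp = record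
    { k          = k
    ; X          = X
    ; start      = start
    ; len        = len
    ; decomposes = decomposes
    ; X-column   = λ i → AllPairs⇒Linked
        (gap-sorted X (intervals start len) (subst Sorted decomposes sorted) i)
    ; X-disjoint = disjoint
    ; start-odd  = Block.start-odd ∘ block
    ; len-even   = Block.len-even ∘ block
    ; len≥2      = Block.len≥2 ∘ block
    ; A-maximal  = block⇒maximal positive ∘ block
    ; t≡∑        = trans (sym length≡t)
        (trans (cong length decomposes) (length-interleave X start len))
    ; 1≤t        = 1≤t
    ; t≤n        = bounded⇒t≤n bounded
    ; start≥     = bounded⇒start≥ X start len parsed (subst (Bounded 0) decomposes bounded)
    }
    where
    open Parsing (parse word sorted)
    bounded : Bounded 0 word
    bounded = symplectic⇒bounded sp
    disjoint : Disjoint s⟦ concat (tabulate X) ⟧ ⟦ word ⟧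
    disjoint (z∈s⟦R⟧ , z∈)
      with _ , +x∈ , refl ← ∈-map⁻ s z∈s⟦R⟧
      with x , x∈R , refl ← ∈-map⁻ +_ +x∈
      with i , x∈Xi ← ∈-concat-tabulate⁻ X x∈R
      with y , y∈ , x⋈y ← s∈⟦⟧⁻ (All.lookup positive (X⊆w i x∈Xi)) z∈
      = lone i x∈Xi y∈ x⋈y

  module _ (D : Decomposition 𝐚) where
    open Decomposition D

    -- Turns disjointness from the `s`-image and global maximality into the local conditions on
    -- which both the symplectic bound and uniqueness rest.
    decomposition⇒parse : Parse word X start len
    decomposition⇒parse = record
      { lone  = λ i x∈ y∈ x⋈y → X-disjoint
          ( ∈-map⁺ s (∈-map⁺ +_ (∈-concat-tabulate⁺ X i x∈)) , s∈⟦⟧⁺ x⋈y y∈)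
      ; block = λ i → maximal⇒block (start-odd i) (len-even i) (len≥2 i) (A-maximal i)
      }

    open Parse decomposition⇒parse

    decomposition⇒symplectic : IsSymplectic 𝐚
    decomposition⇒symplectic = bounded⇒symplectic (subst (Bounded 0) (sym decomposes)
      (start≥⇒bounded X start len decomposition⇒parse start≥
        (subst Sorted decomposes sorted)
        (⊆-reflexive (sym decomposes))
        -- At offset 0 the initial bound is just positivity of the letters.
        (subst (All (0 <_)) decomposes positive)))

    block-partner : ∀ i → x ∈ A i → ∃ λ y → y ∈ word × x ⋈ y
    block-partner i x∈ with y , x⋈y ← partner (All.lookup positive (Block.contained (block i) x∈)) =
      y , Block.contained (block i) (Block.closed (block i) x∈ x⋈y) , x⋈y

    -- Each letter of the word lies in a gap or in a block; gap letters have no partner in the word,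
    -- while blocks contain the partners of their letters.
    ∈-blocks⇔ : ∀ x → x ∈ concat blocks ⇔ (x ∈ word × s (+ x) ∈ ⟦ word ⟧)
    ∈-blocks⇔ x = mk⇔ to from
      where
      to : x ∈ concat blocks → x ∈ word × s (+ x) ∈ ⟦ word ⟧
      to x∈ with i , x∈A ← ∈-concat-tabulate⁻ A x∈
            with y , y∈ , x⋈y ← block-partner i x∈A
        = Block.contained (block i) x∈A , s∈⟦⟧⁺ x⋈y y∈
      from : x ∈ word × s (+ x) ∈ ⟦ word ⟧ → x ∈ concat blocks
      from (x∈ , sx∈)
        with y , y∈ , x⋈y ← s∈⟦⟧⁻ (All.lookup positive x∈) sx∈
           | ∈-interleave⁻ X A (⊆-reflexive decomposes x∈)
      ... | inj₁ (i , x∈X) = contradiction x⋈y (lone i x∈X y∈)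
      ... | inj₂ (i , x∈A) = ∈-concat-tabulate⁺ A i x∈A

    -- Having a partner separates gap letters from block letters, so the filter keeps every gap
    -- whole and erases every block.
    remainder≡ : remainder ≡ word ∖ concat blocks
    remainder≡ = sym (trans (cong (_∖ concat blocks) decomposes)
      (filter-interleave (_∉? concat blocks) X A
        (λ i → All.tabulate (unpaired i))
        (λ i → All.tabulate λ x∈ x∉ → x∉ (∈-concat-tabulate⁺ A i x∈))))
      where
      unpaired : ∀ i {x} → x ∈ X i → x ∉ concat blocks
      unpaired i x∈X x∈ with j , x∈A ← ∈-concat-tabulate⁻ A x∈
        with y , y∈ , x⋈y ← block-partner j x∈A = lone i x∈X y∈ x⋈y

theorem1 : ∀ (n t : ℕ) → 1 ≤ n → 1 ≤ t → (𝐚 : Column n t) →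
    let a = Column.word 𝐚 in
    (IsSymplectic 𝐚 ⇔ Decomposition 𝐚)
    × (∀ (D D′ : Decomposition 𝐚) → Decomposition.blocks D ≡ Decomposition.blocks D′)
    × (∀ (D : Decomposition 𝐚) →
    let As = Decomposition.blocks D in
    AllPairs Disjoint As
    × (∀ x → x ∈ concat As ⇔ (x ∈ a × s (+ x) ∈ ⟦ a ⟧))
    × Decomposition.remainder D ≡ a ∖ concat As
    × Disjoint s⟦ a ∖ concat As ⟧ ⟦ a ⟧)
theorem1 n t _ 1≤t 𝐚 =
  mk⇔ (symplectic⇒decomposition 𝐚 1≤t) (decomposition⇒symplectic 𝐚) ,
  blocks-unique ,
  λ D → let open Decomposition D using (X; A; decomposes; X-disjoint) in
    blocks-disjoint X A (subst Sorted decomposes (sorted 𝐚)) ,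
    ∈-blocks⇔ 𝐚 D ,
    remainder≡ 𝐚 D ,
    subst (λ R → Disjoint s⟦ R ⟧ ⟦ Column.word 𝐚 ⟧) (remainder≡ 𝐚 D) X-disjoint
  where
  blocks-unique : (D D′ : Decomposition 𝐚) → Decomposition.blocks D ≡ Decomposition.blocks D′
  blocks-unique D D′ = parse-unique D.X D.start D.len D′.X D′.start D′.len
    (decomposition⇒parse 𝐚 D) (decomposition⇒parse 𝐚 D′)
    (trans (sym D.decomposes) D′.decomposes)
    where
    module D  = Decomposition D
    module D′ = Decomposition D′
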